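{- Let $\Sigma$ be a set. The Kleisli category $\mathcal{K}l(\mathfrak{D}(\Sigma^\ast\times\mathcal{I}d+\Sigma^\omega))$ described in the context, with the given hom-set ordering, satisfies the following: (A) it is order enriched with a pointwise induced order; (B) it is $\omega\mathsf{Cpo}$-enriched; (C) it is left distributive; (D) its hom-sets are complete lattices.
   Context: For a set $X$ let $\mathfrak{D}X=(X\to[0,1])\to_\omega[0,1]$, where $X\to[0,1]$ is ordered pointwise and $P\to_\omega Q$ is the set of functions from $P$ to $Q$ preserving suprema of (ascending) $\omega$-chains. The category $\mathcal{K}l(\mathfrak{D}(\Sigma^\ast\times\mathcal{I}d+\Sigma^\omega))$: objects are sets; morphisms $f\colon X\rightharpoonup Y$ are maps $f\colon X\to\mathfrak{D}(\Sigma^\ast\times Y+\Sigma^\omega)$, where $\Sigma^\ast$ and $\Sigma^\omega$ are the sets of finite and infinite words over $\Sigma$. Identities are $\mathsf{id}(x)(d)=d(\varepsilon,x)$. For $f\colon X\rightharpoonup Y$ and $g\colon Y\rightharpoonup Z$ and $d\colon\Sigma^\ast\times Z+\Sigma^\omega\to[0,1]$, $$(g\cdot f)(x)(d)=f(x)\big((\sigma,y)\mapsto g(y)(d_{|\sigma}),\ v\mapsto d(v)\big),$$ where $d_{|\sigma}(\tau,z)=d(\sigma\tau,z)$ and $d_{|\sigma}(v)=d(\sigma v)$ for $\tau\in\Sigma^\ast$, $z\in Z$, $v\in\Sigma^\omega$. Ordering: $f\le g$ iff $f(x)(d)\le g(x)(d)$ for all $x\in X$ and all $d\colon\Sigma^\ast\times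 Y+\Sigma^\omega\to[0,1]$. Terminology for a Kleisli category $\mathcal{K}l(M)$ of a $\mathsf{Set}$-monad $M$. Order enriched: hom-sets are posets and composition is monotone. Pointwise induced: each $MY$ is a poset and $f\le g$ iff $f(x)\le g(x)$ for all $x$. $\omega\mathsf{Cpo}$-enriched: every countable ascending chain of morphisms with common domain and codomain has a supremum, preserved by composition on both sides. Left distributive: all finite (possibly empty) suprema exist in hom-posets and $g\cdot\bigvee_{i\in I}f_i=\bigvee_{i\in I}g\cdot f_i$ for every finite $I$. -}

module Defs where

open import Data.Fin.Base using (Fin)
open import Data.List.Base using (List; []; _∷_; _++_)
open import Data.List.Properties using (++-assoc; ++-identityʳ)
open import Data.Nat.Base using (ℕ; zero; suc)
open import Data.Product.Base using (Σ; ∃; _×_; _,_; proj₁; proj₂)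
open import Data.Rational.Base as ℚ using (ℚ; 0ℚ; 1ℚ)
open import Data.Sum.Base using (_⊎_; inj₁; inj₂)
open import Function.Base using (_∘_; flip)
open import Function.Bundles using (_⇔_)
open import Level using (Level; _⊔_; 0ℓ) renaming (suc to lsuc)
open import Relation.Binary.Core using (Rel)
open import Relation.Binary.PropositionalEquality
  using (_≡_; refl; sym; cong)
open import Relation.Binary.Structures using (IsEquivalence; IsPartialOrder)
open import Relation.Unary using (Pred; _∈_; _⊆_; _≐_)

private
  variable
    a b c e i o r ℓ : Level

record IsSup {A : Set a} (_≤_ : Rel A r) {I : Set i} (f : I → A) (s : A)
             : Set (a ⊔ r ⊔ i) where
  field
    upper : ∀ j → f j ≤ s
    least : ∀ u → (∀ j → f j ≤ u) → s ≤ u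

Ascending : {A : Set a} → Rel A r → (ℕ → A) → Set r
Ascending _≤_ c = ∀ n → c n ≤ c (suc n)

ω-Continuous : {A : Set a} {B : Set b} → Rel A r → Rel B e → (A → B) → Set (a ⊔ b ⊔ r ⊔ e)
ω-Continuous _≤₁_ _≤₂_ f =
  ∀ c s → Ascending _≤₁_ c → IsSup _≤₁_ c s → IsSup _≤₂_ (f ∘ c) (f s)

IsSupOf : {A : Set a} → Rel A r → Pred A i → A → Set (a ⊔ r ⊔ i)
IsSupOf {A = A} _≤_ S = IsSup _≤_ {I = Σ A S} proj₁

IsInfOf : {A : Set a} → Rel A r → Pred A i → A → Set (a ⊔ r ⊔ i)
IsInfOf _≤_ = IsSupOf (flip _≤_)

-- Subsets live at the level of the carrier; classically, a subset given by a
-- predicate of any other level is also given by one of this level.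
record IsCompleteLattice {A : Set a} (_≈_ : Rel A e) (_≤_ : Rel A r)
                         : Set (lsuc a ⊔ e ⊔ r) where
  field
    isPartialOrder : IsPartialOrder _≈_ _≤_
    sup            : (S : Pred A a) → ∃ (IsSupOf _≤_ S)
    inf            : (S : Pred A a) → ∃ (IsInfOf _≤_ S)

-- The real unit interval.  A real r ∈ [0,1] is its (open, lower) Dedekind
-- cut { q ∈ ℚ ∣ q < r }: the requirement r ≥ 0 says that the cut contains all
-- negative rationals, and r ≤ 1 that all its elements are < 1.  Read
-- classically, one-sided cuts are exactly the real numbers; without excluded
-- middle they would be the lower reals.

record 𝕀 : Set₁ where
  field
    below    : Pred ℚ 0ℓ
    0≤       : ∀ {q} → q ℚ.< 0ℚ → q ∈ below
    ≤1       : ∀ {q} → q ∈ below → q ℚ.< 1ℚ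
    downward : ∀ {p q} → p ℚ.< q → q ∈ below → p ∈ below
    rounded  : ∀ {p} → p ∈ below → ∃ λ q → p ℚ.< q × q ∈ below

open 𝕀 public using (below)

infix 4 _≤ᴵ_ _≈ᴵ_ _≤̇_

_≤ᴵ_ : Rel 𝕀 0ℓ
x ≤ᴵ y = below x ⊆ below y

_≈ᴵ_ : Rel 𝕀 0ℓ
x ≈ᴵ y = below x ≐ below y

_≤̇_ : {X : Set ℓ} → Rel (X → 𝕀) ℓ
d ≤̇ e = ∀ x → d x ≤ᴵ e x

record 𝔇 (X : Set ℓ) : Set (ℓ ⊔ lsuc 0ℓ) where
  field
    app        : (X → 𝕀) → 𝕀
    continuous : ω-Continuous _≤̇_ _≤ᴵ_ app

open 𝔇 public

infix 4 _≤ᴰ_ _≈ᴰ_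

_≤ᴰ_ : {X : Set ℓ} → Rel (𝔇 X) (ℓ ⊔ lsuc 0ℓ)
F ≤ᴰ G = ∀ d → app F d ≤ᴵ app G d

_≈ᴰ_ : {X : Set ℓ} → Rel (𝔇 X) (ℓ ⊔ lsuc 0ℓ)
F ≈ᴰ G = ∀ d → app F d ≈ᴵ app G d

-- Suprema of ω-chains in X → [0,1] are pointwise; needed for composition of
-- Kleisli morphisms to be well defined.

⋃ : (ℕ → 𝕀) → 𝕀
⋃ c = record
  { below    = λ q → ∃ λ n → q ∈ below (c n)
  ; 0≤       = λ q<0 → 0 , 𝕀.0≤ (c 0) q<0
  ; ≤1       = λ (n , q∈) → 𝕀.≤1 (c n) q∈
  ; downward = λ p<q (n , q∈) → n , 𝕀.downward (c n) p<q q∈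
  ; rounded  = λ (n , p∈) → let q , p<q , q∈ = 𝕀.rounded (c n) p∈ in q , p<q , n , q∈
  }

sup⇒pointwise-sup : {X : Set ℓ} {c : ℕ → X → 𝕀} {s : X → 𝕀} → IsSup _≤̇_ c s →
                    ∀ x → IsSup _≤ᴵ_ (λ n → c n x) (s x)
sup⇒pointwise-sup {c = c} {s} isSup x = record
  { upper = λ n → IsSup.upper isSup n x
  ; least = λ u c≤u q∈ →
      let n , q∈cₙ = IsSup.least isSup (λ y → ⋃ (λ n → c n y)) (λ n y q∈ → n , q∈) x q∈
      in c≤u n q∈cₙ
  }

pointwise-sup⇒sup : {X : Set ℓ} {c : ℕ → X → 𝕀} {s : X → 𝕀} →
                    (∀ x → IsSup _≤ᴵ_ (λ n → c n x) (s x)) → IsSup _≤̇_ c s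
pointwise-sup⇒sup isSup = record
  { upper = λ n x → IsSup.upper (isSup x) n
  ; least = λ u c≤u x → IsSup.least (isSup x) (u x) (λ n → c≤u n x)
  }

≡⇒≈ᴵ : {x y : 𝕀} → x ≡ y → x ≈ᴵ y
≡⇒≈ᴵ refl = (λ q∈ → q∈) , (λ q∈ → q∈)

≈ᴵ-trans : ∀ x y z → x ≈ᴵ y → y ≈ᴵ z → x ≈ᴵ z
≈ᴵ-trans x y z (p , q) (p′ , q′) = (λ q∈ → p′ (p q∈)) , (λ q∈ → q (q′ q∈))

app-mono : {X : Set ℓ} (F : 𝔇 X) {d e : X → 𝕀} → d ≤̇ e → app F d ≤ᴵ app F e
app-mono F {d} {e} d≤e =
  IsSup.upper (continuous F chain e ascending record
    { upper = λ { zero → d≤e ; (suc n) x q∈ → q∈ }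
    ; least = λ u c≤u → c≤u 1 }) 0
  where
  chain : ℕ → _ → 𝕀
  chain zero    = d
  chain (suc n) = e

  ascending : Ascending _≤̇_ chain
  ascending zero    = d≤e
  ascending (suc n) = λ x q∈ → q∈

app-cong : {X : Set ℓ} (F : 𝔇 X) {d e : X → 𝕀} → (∀ x → d x ≈ᴵ e x) → app F d ≈ᴵ app F e
app-cong F d≈e = app-mono F (proj₁ ∘ d≈e) , app-mono F (proj₂ ∘ d≈e)

record Category o h e : Set (lsuc (o ⊔ h ⊔ e)) where
  infixr 9 _·_
  infix  4 _≈_
  field
    Obj       : Set o
    Hom       : Obj → Obj → Set h
    _≈_       : ∀ {X Y} → Rel (Hom X Y) e
    id        : ∀ {X} → Hom X X
    _·_       : ∀ {X Y Z} → Hom Y Z → Hom X Y → Hom X Z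
    isEquivalence : ∀ {X Y} → IsEquivalence (_≈_ {X} {Y})
    ·-cong    : ∀ {X Y Z} {g g′ : Hom Y Z} {f f′ : Hom X Y} →
                g ≈ g′ → f ≈ f′ → g · f ≈ g′ · f′
    identityˡ : ∀ {X Y} (f : Hom X Y) → id · f ≈ f
    identityʳ : ∀ {X Y} (f : Hom X Y) → f · id ≈ f
    assoc     : ∀ {W X Y Z} (h : Hom Y Z) (g : Hom X Y) (f : Hom W X) →
                (h · g) · f ≈ h · (g · f)

module _ {o h e r} (C : Category o h e)
         (_≤_ : ∀ {X Y} → Rel (Category.Hom C X Y) r) where
  open Category C

  record OrderEnriched : Set (o ⊔ h ⊔ e ⊔ r) where
    field
      isPartialOrder : ∀ {X Y} → IsPartialOrder (_≈_ {X} {Y}) _≤_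
      ·-mono         : ∀ {X Y Z} {g g′ : Hom Y Z} {f f′ : Hom X Y} →
                       g ≤ g′ → f ≤ f′ → (g · f) ≤ (g′ · f′)

  record ωCpoEnriched : Set (o ⊔ h ⊔ r) where
    field
      sup       : ∀ {X Y} (c : ℕ → Hom X Y) → Ascending _≤_ c → ∃ (IsSup _≤_ c)
      preserveˡ : ∀ {X Y Z} (g : Hom Y Z) (c : ℕ → Hom X Y) (s : Hom X Y) →
                  Ascending _≤_ c → IsSup _≤_ c s → IsSup _≤_ (λ n → g · c n) (g · s)
      preserveʳ : ∀ {X Y Z} (c : ℕ → Hom Y Z) (s : Hom Y Z) (f : Hom X Y) →
                  Ascending _≤_ c → IsSup _≤_ c s → IsSup _≤_ (λ n → c n · f) (s · f)

  record LeftDistributive : Set (o ⊔ h ⊔ r) where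
    field
      finiteSup  : ∀ {X Y} n (f : Fin n → Hom X Y) → ∃ (IsSup _≤_ f)
      distribute : ∀ {X Y Z} n (g : Hom Y Z) (f : Fin n → Hom X Y) (s : Hom X Y) →
                   IsSup _≤_ f s → IsSup _≤_ (λ j → g · f j) (g · s)

  HomsCompleteLattices : Set (o ⊔ lsuc h ⊔ e ⊔ r)
  HomsCompleteLattices = ∀ X Y → IsCompleteLattice (_≈_ {X} {Y}) _≤_

-- For Kleisli morphisms X → M Y, where M Y carries the order _⊑_.
record PointwiseInduced {M : Set ℓ → Set a}
                        (_≈_ : ∀ {Y} → Rel (M Y) e)
                        (_⊑_ : ∀ {Y} → Rel (M Y) r)
                        (_≤_ : ∀ {X Y : Set ℓ} → Rel (X → M Y) i)
                        : Set (lsuc ℓ ⊔ a ⊔ e ⊔ r ⊔ i) where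
  field
    isPartialOrder : ∀ {Y} → IsPartialOrder (_≈_ {Y}) _⊑_
    pointwise      : ∀ {X Y : Set ℓ} (f g : X → M Y) → (f ≤ g) ⇔ (∀ x → f x ⊑ g x)

-- The Kleisli category of 𝔇(Σ* × Id + Σ^ω), with A in the role of Σ.
-- For ℓ of the form lsuc 0ℓ ⊔ ℓ′ the functor T below maps Set ℓ to itself.

module _ (A : Set ℓ) where

  -- Words are compared by _≡_; nothing below needs function extensionality to
  -- identify pointwise equal ones.
  Word^ω : Set ℓ
  Word^ω = ℕ → A

  Outcome : Set ℓ → Set ℓ
  Outcome Y = (List A × Y) ⊎ Word^ω

  T : Set ℓ → Set (ℓ ⊔ lsuc 0ℓ)
  T Y = 𝔇 (Outcome Y)

  cons : A → Word^ω → Word^ω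
  cons x v zero    = x
  cons x v (suc n) = v n

  prepend : List A → Word^ω → Word^ω
  prepend []      v = v
  prepend (x ∷ σ) v = cons x (prepend σ v)

module _ {A : Set ℓ} where

  infix  4 _≤ᴷ_ _≈ᴷ_
  infixr 9 _·ᴷ_
  infixl 8 _∣_

  -- d ∣ σ is the d_{|σ} of the composition formula.
  _∣_ : {Z : Set ℓ} → (Outcome A Z → 𝕀) → List A → (Outcome A Z → 𝕀)
  (d ∣ σ) (inj₁ (τ , z)) = d (inj₁ (σ ++ τ , z))
  (d ∣ σ) (inj₂ v)       = d (inj₂ (prepend A σ v))

  -- The argument ((σ , y) ↦ g(y)(d_{|σ}) , v ↦ d(v)) that g · f passes to f(x).
  extend : {Y Z : Set ℓ} → (Y → T A Z) → (Outcome A Z → 𝕀) → (Outcome A Y → 𝕀)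
  extend g d (inj₁ (σ , y)) = app (g y) (d ∣ σ)
  extend g d (inj₂ v)       = d (inj₂ v)

  ∣-mono : {Z : Set ℓ} {d e : Outcome A Z → 𝕀} → d ≤̇ e → ∀ σ → d ∣ σ ≤̇ e ∣ σ
  ∣-mono d≤e σ (inj₁ (τ , z)) = d≤e (inj₁ (σ ++ τ , z))
  ∣-mono d≤e σ (inj₂ v)       = d≤e (inj₂ (prepend A σ v))

  extend-mono : {Y Z : Set ℓ} (g : Y → T A Z) {d e : Outcome A Z → 𝕀} →
                d ≤̇ e → extend g d ≤̇ extend g e
  extend-mono g d≤e (inj₁ (σ , y)) = app-mono (g y) (∣-mono d≤e σ)
  extend-mono g d≤e (inj₂ v)       = d≤e (inj₂ v)

  ∣-sup : {Z : Set ℓ} {c : ℕ → Outcome A Z → 𝕀} {s : Outcome A Z → 𝕀} →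
          IsSup _≤̇_ c s → ∀ σ → IsSup _≤̇_ (λ n → c n ∣ σ) (s ∣ σ)
  ∣-sup isSup σ = pointwise-sup⇒sup λ where
    (inj₁ (τ , z)) → sup⇒pointwise-sup isSup (inj₁ (σ ++ τ , z))
    (inj₂ v)       → sup⇒pointwise-sup isSup (inj₂ (prepend A σ v))

  extend-sup : {Y Z : Set ℓ} (g : Y → T A Z) → ∀ {c s} → Ascending _≤̇_ c →
               IsSup _≤̇_ c s → IsSup _≤̇_ (λ n → extend g (c n)) (extend g s)
  extend-sup g {c} {s} asc isSup = pointwise-sup⇒sup λ where
    (inj₁ (σ , y)) → continuous (g y) (λ n → c n ∣ σ) (s ∣ σ)
                       (λ n → ∣-mono (asc n) σ) (∣-sup isSup σ)
    (inj₂ v)       → sup⇒pointwise-sup isSup (inj₂ v)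

  idᴷ : {X : Set ℓ} → X → T A X
  idᴷ x = record
    { app        = λ d → d (inj₁ ([] , x))
    ; continuous = λ c s asc isSup → sup⇒pointwise-sup isSup (inj₁ ([] , x))
    }

  _·ᴷ_ : {X Y Z : Set ℓ} → (Y → T A Z) → (X → T A Y) → (X → T A Z)
  (g ·ᴷ f) x = record
    { app        = λ d → app (f x) (extend g d)
    ; continuous = λ c s asc isSup →
        continuous (f x) (λ n → extend g (c n)) (extend g s)
          (λ n → extend-mono g (asc n)) (extend-sup g asc isSup)
    }

  _≤ᴷ_ : {X Y : Set ℓ} → Rel (X → T A Y) (ℓ ⊔ lsuc 0ℓ)
  f ≤ᴷ g = ∀ x d → app (f x) d ≤ᴵ app (g x) d

  _≈ᴷ_ : {X Y : Set ℓ} → Rel (X → T A Y) (ℓ ⊔ lsuc 0ℓ)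
  f ≈ᴷ g = ∀ x d → app (f x) d ≈ᴵ app (g x) d

  ∣-[] : {Z : Set ℓ} (d : Outcome A Z → 𝕀) → ∀ w → (d ∣ []) w ≡ d w
  ∣-[] d (inj₁ (τ , z)) = refl
  ∣-[] d (inj₂ v)       = refl

  ∣-++ : {Z : Set ℓ} (d : Outcome A Z → 𝕀) (σ τ : List A) →
         ∀ w → (d ∣ (σ ++ τ)) w ≡ (d ∣ σ ∣ τ) w
  ∣-++ d σ τ (inj₁ (ρ , z)) = cong (λ υ → d (inj₁ (υ , z))) (++-assoc σ τ ρ)
  ∣-++ d σ τ (inj₂ v)       = cong (d ∘ inj₂) (prepend-++ σ)
    where
    prepend-++ : ∀ σ → prepend A (σ ++ τ) v ≡ prepend A σ (prepend A τ v)
    prepend-++ []      = refl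
    prepend-++ (x ∷ σ) = cong (cons A x) (prepend-++ σ)

  extend-cong : {Y Z : Set ℓ} {g g′ : Y → T A Z} → g ≈ᴷ g′ →
                ∀ d w → extend g d w ≈ᴵ extend g′ d w
  extend-cong g≈g′ d (inj₁ (σ , y)) = g≈g′ y (d ∣ σ)
  extend-cong g≈g′ d (inj₂ v)       = ≡⇒≈ᴵ {d (inj₂ v)} refl

  extend-id : {Y : Set ℓ} (d : Outcome A Y → 𝕀) → ∀ w → extend idᴷ d w ≈ᴵ d w
  extend-id d (inj₁ (σ , y)) = ≡⇒≈ᴵ (cong (λ τ → d (inj₁ (τ , y))) (++-identityʳ σ))
  extend-id d (inj₂ v)       = ≡⇒≈ᴵ {d (inj₂ v)} refl

  extend-∣ : {Y Z : Set ℓ} (g : Y → T A Z) (d : Outcome A Z → 𝕀) (σ : List A) →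
             ∀ w → extend g (d ∣ σ) w ≈ᴵ (extend g d ∣ σ) w
  extend-∣ g d σ (inj₁ (τ , y)) =
    app-cong (g y) (λ w → ≡⇒≈ᴵ (sym (∣-++ d σ τ w)))
  extend-∣ g d σ (inj₂ v)       = ≡⇒≈ᴵ {d (inj₂ (prepend A σ v))} refl

  extend-· : {X Y Z : Set ℓ} (h : Y → T A Z) (g : X → T A Y) (d : Outcome A Z → 𝕀) →
             ∀ w → extend (h ·ᴷ g) d w ≈ᴵ extend g (extend h d) w
  extend-· h g d (inj₁ (σ , x)) = app-cong (g x) (extend-∣ h d σ)
  extend-· h g d (inj₂ v)       = ≡⇒≈ᴵ {d (inj₂ v)} refl

Kl : (A : Set ℓ) → Category (lsuc ℓ) (ℓ ⊔ lsuc 0ℓ) (ℓ ⊔ lsuc 0ℓ)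
Kl {ℓ} A = record
  { Obj           = Set ℓ
  ; Hom           = λ X Y → X → T A Y
  ; _≈_           = _≈ᴷ_
  ; id            = idᴷ
  ; _·_           = _·ᴷ_
  ; isEquivalence = record
    { refl  = λ {f} x d → ≡⇒≈ᴵ {app (f x) d} refl
    ; sym   = λ p x d → proj₂ (p x d) , proj₁ (p x d)
    ; trans = λ {f} {g} {h} p q x d →
        ≈ᴵ-trans (app (f x) d) (app (g x) d) (app (h x) d) (p x d) (q x d)
    }
  ; ·-cong        = λ {_} {_} {_} {g} {g′} {f} {f′} g≈g′ f≈f′ x d →
      ≈ᴵ-trans (app ((g ·ᴷ f) x) d) (app ((g′ ·ᴷ f) x) d) (app ((g′ ·ᴷ f′) x) d)
        (app-cong (f x) (extend-cong {g = g} {g′ = g′} g≈g′ d)) (f≈f′ x (extend g′ d))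
  ; identityˡ     = λ f x d → app-cong (f x) (extend-id d)
  ; identityʳ     = λ f x d → app-cong (f x) (λ w → ≡⇒≈ᴵ (∣-[] d w))
  ; assoc         = λ h g f x d → app-cong (f x) (extend-· h g d)
  }

{-# OPTIONS --safe #-}

-- Arbitrary suprema of ω-continuous functionals are computed pointwise, since
-- suprema commute with suprema.  Hence any supremum of Kleisli morphisms is
-- pointwise, so that precomposing the functionals with extend g (composition on
-- the left) preserves all suprema, while composition on the right preserves the
-- suprema of ω-chains by the ω-continuity of functionals.  Infima are suprema of
-- lower bounds.

module Submission where

open import Defs
open import Axiom.ExcludedMiddle using (ExcludedMiddle)
open import Data.Nat.Base using (ℕ)
open import Data.Product using (∃; _×_; _,_; proj₁; proj₂)
open import Data.Rational.Base as ℚ using (0ℚ; 1ℚ)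
import Data.Rational.Properties as ℚ
open import Data.Sum.Base using (_⊎_; inj₁; inj₂; [_,_]′)
open import Function.Base using (id; _∘_)
open import Function.Bundles using (mk⇔)
open import Level using (Level; _⊔_; 0ℓ; suc; Lift; lift; lower)
open import Relation.Binary.Core using (Rel)
open import Relation.Binary.Structures using (IsPartialOrder)
open import Relation.Nullary.Decidable using (True; toWitness; fromWitness; map′)
open import Relation.Unary using (Pred; _∈_)

private
  variable
    a b i r ℓ : Level
    A X Y : Set ℓ

lowerEM : ExcludedMiddle (a ⊔ b) → ExcludedMiddle a
lowerEM {b = b} em {P} = map′ lower lift (em {Lift b P})

lowerBounds : {A : Set a} → Rel A r → Pred A i → Pred A (a ⊔ r ⊔ i)
lowerBounds _≤_ S x = ∀ y → y ∈ S → x ≤ y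

-- Every element of `S` bounds the set of lower bounds from above, so the supremum of that set lies
-- below it and is itself a lower bound.
supOfLowerBounds⇒inf : {A : Set a} {_≤_ : Rel A r} {S : Pred A i} {s : A} →
                       IsSupOf _≤_ (lowerBounds _≤_ S) s → IsInfOf _≤_ S s
supOfLowerBounds⇒inf isSup = record
  { upper = λ (y , y∈S) → IsSup.least isSup y (λ (x , x≤S) → x≤S y y∈S)
  ; least = λ u u≤S → IsSup.upper isSup (u , λ y y∈S → u≤S (y , y∈S))
  }

≤ᴰ-isPartialOrder : IsPartialOrder (_≈ᴰ_ {X = X}) _≤ᴰ_
≤ᴰ-isPartialOrder = record
  { isPreorder = record
    { isEquivalence = record
      { refl  = λ d → id , id
      ; sym   = λ p d → proj₂ (p d) , proj₁ (p d)
      ; trans = λ p q d → proj₁ (q d) ∘ proj₁ (p d) , proj₂ (p d) ∘ proj₂ (q d)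
      }
    ; reflexive = λ p d → proj₁ (p d)
    ; trans     = λ p q d → q d ∘ p d
    }
  ; antisym = λ p q d → p d , q d
  }

≤ᴷ-isPartialOrder : IsPartialOrder (_≈ᴷ_ {A = A} {X} {Y}) _≤ᴷ_
≤ᴷ-isPartialOrder {A = A} = record
  { isPreorder = record
    { isEquivalence = Category.isEquivalence (Kl A)
    ; reflexive     = λ p x d → proj₁ (p x d)
    ; trans         = λ p q x d → q x d ∘ p x d
    }
  ; antisym = λ p q x d → p x d , q x d
  }

extend-monoˡ : {A Y Z : Set ℓ} {g h : Y → T A Z} → g ≤ᴷ h → ∀ d → extend g d ≤̇ extend h d
extend-monoˡ g≤h d (inj₁ (σ , y)) = g≤h y (d ∣ σ)
extend-monoˡ g≤h d (inj₂ v)       = id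

·ᴷ-mono : {A X Y Z : Set ℓ} {g h : Y → T A Z} {f k : X → T A Y} →
          g ≤ᴷ h → f ≤ᴷ k → g ·ᴷ f ≤ᴷ h ·ᴷ k
·ᴷ-mono {g = g} {h} {f} g≤h f≤k x d =
  -- First `g` becomes `h` under the monotone functional `f x`, then `f x` becomes `k x` at the
  -- fixed argument `extend h d`.
  f≤k x (extend h d) ∘ app-mono (f x) (extend-monoˡ {g = g} {h} g≤h d)

module _ (em : ExcludedMiddle i) {I : Set i} where

  -- True resizes the existential to level 0; the first summand makes the empty
  -- supremum 0.
  ⨆ᴵ : (I → 𝕀) → 𝕀
  ⨆ᴵ x = record
    { below    = λ q → q ℚ.< 0ℚ ⊎ True (em {∃ λ j → q ∈ below (x j)})
    ; 0≤       = inj₁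
    ; ≤1       = [ (λ q<0 → ℚ.<-trans q<0 (ℚ.positive⁻¹ 1ℚ))
                 , (λ t → let j , q∈ = toWitness t in 𝕀.≤1 (x j) q∈) ]′
    ; downward = λ p<q → λ where
        (inj₁ q<0) → inj₁ (ℚ.<-trans p<q q<0)
        (inj₂ t)   → let j , q∈ = toWitness t
                     in inj₂ (fromWitness (j , 𝕀.downward (x j) p<q q∈))
    ; rounded  = λ where
        (inj₁ p<0) → let q , p<q , q<0 = ℚ.<-dense p<0 in q , p<q , inj₁ q<0
        (inj₂ t)   → let j , p∈ = toWitness t
                         q , p<q , q∈ = 𝕀.rounded (x j) p∈
                     in q , p<q , inj₂ (fromWitness (j , q∈))
    }

  ⨆ᴵ-isSup : ∀ x → IsSup _≤ᴵ_ x (⨆ᴵ x)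
  ⨆ᴵ-isSup x = record
    { upper = λ j q∈ → inj₂ (fromWitness (j , q∈))
    ; least = λ u x≤u → λ where
        -- Every cut contains the negative rationals, so this case holds even for empty `I`.
        (inj₁ q<0) → 𝕀.0≤ u q<0
        (inj₂ t)   → let j , q∈ = toWitness t in x≤u j q∈
    }

  ⨆ᴰ : {X : Set ℓ} → (I → 𝔇 X) → 𝔇 X
  ⨆ᴰ F = record
    { app        = λ d → ⨆ᴵ (λ j → app (F j) d)
    ; continuous = λ c s asc isSup → record
      { upper = λ n → IsSup.least (isSup-at (c n)) (⨆ᴵ λ j → app (F j) s) λ j →
          IsSup.upper (isSup-at s) j ∘ IsSup.upper (continuous (F j) c s asc isSup) n
      -- A bound for all `n` bounds every `app (F j) (c n)`, hence by continuity every
      -- `app (F j) s`, hence their supremum.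
      ; least = λ u F≤u → IsSup.least (isSup-at s) u λ j →
          IsSup.least (continuous (F j) c s asc isSup) u λ n →
          F≤u n ∘ IsSup.upper (isSup-at (c n)) j
      }
    }
    where
    isSup-at : ∀ d → IsSup _≤ᴵ_ (λ j → app (F j) d) (⨆ᴵ λ j → app (F j) d)
    isSup-at d = ⨆ᴵ-isSup λ j → app (F j) d

  ⨆ᴷ : {A X Y : Set ℓ} → (I → X → T A Y) → X → T A Y
  ⨆ᴷ f x = ⨆ᴰ (λ j → f j x)

  ⨆ᴷ-isSup : {A X Y : Set ℓ} (f : I → X → T A Y) → IsSup _≤ᴷ_ f (⨆ᴷ f)
  ⨆ᴷ-isSup f = record
    { upper = λ j x d → IsSup.upper (⨆ᴵ-isSup (λ j → app (f j x) d)) j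
    ; least = λ u f≤u x d →
        IsSup.least (⨆ᴵ-isSup (λ j → app (f j x) d)) (app (u x) d) (λ j → f≤u j x d)
    }

  -- The bound `u` is a single number, so leastness of `s` cannot be applied to it directly. Instead
  -- `s` lies below the particular upper bound `⨆ᴷ f`, whose values are suprema by construction.
  supᴷ⇒pointwise-sup : {A X Y : Set ℓ} {f : I → X → T A Y} {s : X → T A Y} →
    IsSup _≤ᴷ_ f s → ∀ x d → IsSup _≤ᴵ_ (λ j → app (f j x) d) (app (s x) d)
  supᴷ⇒pointwise-sup {f = f} isSup x d = record
    { upper = λ j → IsSup.upper isSup j x d
    ; least = λ u f≤u →
        IsSup.least (⨆ᴵ-isSup (λ j → app (f j x) d)) u f≤u ∘
        IsSup.least isSup (⨆ᴷ f) (IsSup.upper (⨆ᴷ-isSup f)) x d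
    }

  -- Composing with `g` only moves the evaluation of `f j x` from `d` to `extend g d`. The index
  -- type is arbitrary, which covers both chains and finite families.
  ·ᴷ-preserveˡ : {A X Y Z : Set ℓ} (g : Y → T A Z) {f : I → X → T A Y} {s : X → T A Y} →
                 IsSup _≤ᴷ_ f s → IsSup _≤ᴷ_ (λ j → g ·ᴷ f j) (g ·ᴷ s)
  ·ᴷ-preserveˡ g isSup = record
    { upper = λ j x d → IsSup.upper isSup j x (extend g d)
    ; least = λ u g·f≤u x d → IsSup.least (supᴷ⇒pointwise-sup isSup x (extend g d))
                                (app (u x) d) (λ j → g·f≤u j x d)
    }

module _ (em : ExcludedMiddle 0ℓ) where

  extend-supˡ : {A Y Z : Set ℓ} {c : ℕ → Y → T A Z} {s : Y → T A Z} →
                IsSup _≤ᴷ_ c s → ∀ d → IsSup _≤̇_ (λ n → extend (c n) d) (extend s d)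
  extend-supˡ isSup d = pointwise-sup⇒sup λ where
    (inj₁ (σ , y)) → supᴷ⇒pointwise-sup em isSup y (d ∣ σ)
    -- On infinite words the chain is constant; its value is the supremum because there is an index,
    -- here `0`.
    (inj₂ v)       → record { upper = λ n → id ; least = λ u d≤u → d≤u 0 }

  -- Here the functional `f x` is fixed and its argument `extend (c n) d` varies. These arguments
  -- ascend to `extend s d`, so the continuity of `f x` applies.
  ·ᴷ-preserveʳ : {A X Y Z : Set ℓ} {c : ℕ → Y → T A Z} {s : Y → T A Z} (f : X → T A Y) →
                 Ascending _≤ᴷ_ c → IsSup _≤ᴷ_ c s → IsSup _≤ᴷ_ (λ n → c n ·ᴷ f) (s ·ᴷ f)
  ·ᴷ-preserveʳ {c = c} {s} f asc isSup = record
    { upper = λ n x d → IsSup.upper (appSup x d) n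
    ; least = λ u c·f≤u x d → IsSup.least (appSup x d) (app (u x) d) (λ n → c·f≤u n x d)
    }
    where
    appSup : ∀ x d → IsSup _≤ᴵ_ (λ n → app ((c n ·ᴷ f) x) d) (app ((s ·ᴷ f) x) d)
    appSup x d = continuous (f x) (λ n → extend (c n) d) (extend s d)
      (λ n → extend-monoˡ {g = c n} {c (ℕ.suc n)} (asc n) d) (extend-supˡ isSup d)

theorem6p4 : ∀ {ℓ : Level} → ExcludedMiddle (ℓ ⊔ suc 0ℓ) → (A : Set ℓ) →
    (OrderEnriched (Kl A) _≤ᴷ_ × PointwiseInduced {M = T A} _≈ᴰ_ _≤ᴰ_ _≤ᴷ_) ×
    ωCpoEnriched (Kl A) _≤ᴷ_ ×
    LeftDistributive (Kl A) _≤ᴷ_ ×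
    HomsCompleteLattices (Kl A) _≤ᴷ_
theorem6p4 {ℓ} em A =
    ( record
      { isPartialOrder = ≤ᴷ-isPartialOrder
      ; ·-mono         = λ {_} {_} {_} {g} {h} {f} {k} → ·ᴷ-mono {g = g} {h} {f} {k}
      }
    , record
      { isPartialOrder = ≤ᴰ-isPartialOrder
      ; pointwise      = λ f g → mk⇔ id id
      }
    )
  , record
    { sup       = λ c asc → ⨆ᴷ em₀ c , ⨆ᴷ-isSup em₀ c
    ; preserveˡ = λ g c s asc → ·ᴷ-preserveˡ em₀ g
    ; preserveʳ = λ c s f → ·ᴷ-preserveʳ em₀ f
    }
  , record
    { finiteSup  = λ n f → ⨆ᴷ em₀ f , ⨆ᴷ-isSup em₀ f
    ; distribute = λ n g f s → ·ᴷ-preserveˡ em₀ g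
    }
  , λ X Y → record
    { isPartialOrder = ≤ᴷ-isPartialOrder
    -- A subset of a hom-set, like the set of its lower bounds, is an index type at the level of
    -- `em`; chains and finite families are indexed at level `0ℓ` and use `em₀`.
    ; sup            = λ S → ⨆ᴷ em proj₁ , ⨆ᴷ-isSup em proj₁
    ; inf            = λ S → ⨆ᴷ em proj₁ ,
                         supOfLowerBounds⇒inf {S = S} (⨆ᴷ-isSup em proj₁)
    }
  where
  em₀ : ExcludedMiddle 0ℓ
  em₀ = lowerEM {b = ℓ ⊔ suc 0ℓ} em
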